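{- Let $\Gamma$ be a set of s-formulas, and suppose that there is a tableau for $\Gamma$ such that every maximal branch of the tableau is closed. Then no frame satisfies $\Gamma$.
   Context: Fix an infinite (possibly uncountable) set $\Sigma$ of propositional variables. Propositional formulas are built from $\Sigma$ using $\lnot$, $\land$, $\lor$, $\to$. An s-formula is an expression of the form $A \prec B$ (a strict implication) or $A \not\prec B$ (a strict nonimplication), where $A$ and $B$ are propositional formulas; $\prec$ and $\not\prec$ are two formal symbols, not nested. A valuation is a function $w:\Sigma\to\{T,F\}$, extended in the usual way to all propositional formulas. A frame is a nonempty set of valuations. A frame $R$ satisfies $A \prec B$ if for every $w\in R$, $w(A)=F$ or $w(B)=T$. A frame $R$ satisfies $A\not\prec B$ if there is some $w\in R$ with $w(A)=T$ and $w(B)=F$. A frame satisfies a set of s-formulas if it satisfies every member. Fix an infinite set $W$ of world variables. A tableau formula is either an s-formula or an expression $(A,w)$ with $A$ a propositional formula and $w\in W$. A tableau for a set $\Gamma$ of tableau formulas is a finite tree whose nodes are labeled by (possibly infinite) sets of tableau formulas, whose root is labeled $\Gamma$, and in which the children of each non-leaf node are obtained from that node by one of the following rules. Below, $\Delta$ is any set of tableau formulas, "$\Delta,\varphi$" means $\Delta\cup\{\varphi\}$ ($\Delta$ may itself contain $\varphi$), the label of the parent is on the left of $\Rightarrow$ and the labels of its one or two children (separated by $\mid$) are on the right: - ($\lor$) $\Delta,(A\lor B,w)\Rightarrow \Delta,(A,w)\mid \Delta,(B,w)$ - ($\lnot\lor$) $\Delta,(\lnot(A\lor B),w)\Rightarrow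 \Delta,(\lnot A,w),(\lnot B,w)$ - ($\land$) $\Delta,(A\land B,w)\Rightarrow \Delta,(A,w),(B,w)$ - ($\lnot\land$) $\Delta,(\lnot(A\land B),w)\Rightarrow \Delta,(\lnot A,w)\mid \Delta,(\lnot B,w)$ - ($\to$) $\Delta,(A\to B,w)\Rightarrow \Delta,(\lnot A,w)\mid\Delta,(B,w)$ - ($\lnot\to$) $\Delta,(\lnot(A\to B),w)\Rightarrow\Delta,(A,w),(\lnot B,w)$ - ($\prec$) $\Delta, A\prec B\Rightarrow \Delta,(\lnot A,w)\mid\Delta,(B,w)$, for any $w\in W$ - ($\not\prec$) $\Delta, A\not\prec B\Rightarrow \Delta,(A,v),(\lnot B,v)$, where $v\in W$ is new: it is not mentioned in the label of the node where the rule is applied or of any of its ancestors - ($C$) $\Delta\Rightarrow \Delta,(A,w)\mid\Delta,(\lnot A,w)$, for any propositional formula $A$ and $w\in W$ - ($\lnot\lnot$) $\Delta,(\lnot\lnot A,w)\Rightarrow\Delta,(A,w)$. A branch is closed if it contains a node whose label contains both $(A,w)$ and $(\lnot A,w)$ for some propositional formula $A$ and some $w\in W$. A tableau is closed if every maximal branch is closed. -}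

module Defs where

open import Data.Bool.Base using (Bool; true; false; not; _∧_; _∨_)
open import Data.Empty.Polymorphic using (⊥)
open import Data.Fin.Base using (Fin)
open import Data.List.Base using (List; []; _∷_)
open import Data.List.Membership.Propositional using () renaming (_∈_ to _∈ˡ_)
open import Data.List.Relation.Binary.Pointwise.Base using (Pointwise)
open import Data.List.Relation.Unary.All using (All)
open import Data.List.Relation.Unary.Any using (Any)
open import Data.Product.Base using (∃; ∃-syntax; _×_)
open import Data.Sum.Base using (_⊎_)
open import Function.Bundles using (_↔_)
open import Level using (Level; _⊔_; suc)
open import Relation.Binary.PropositionalEquality using (_≡_)
open import Relation.Nullary using (¬_)
open import Relation.Unary using (Pred; _∈_; _≐_; _∪_; Satisfiable)

private
  variable
    a b ℓ γ r : Level

Infinite : Set a → Set a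
Infinite A = ¬ (∃[ n ] (A ↔ Fin n))

infix  9 ¬ᶠ_
infixr 8 _∧ᶠ_
infixr 7 _∨ᶠ_
infixr 6 _→ᶠ_
infix  5 _≺_ _⊀_

data Formula (P : Set a) : Set a where
  var            : P → Formula P
  ¬ᶠ_            : Formula P → Formula P
  _∧ᶠ_ _∨ᶠ_ _→ᶠ_ : Formula P → Formula P → Formula P

data SFormula (P : Set a) : Set a where
  _≺_ _⊀_ : Formula P → Formula P → SFormula P

Valuation : Set a → Set a
Valuation P = P → Bool

eval : {P : Set a} → Valuation P → Formula P → Bool
eval u (var p)  = u p
eval u (¬ᶠ A)   = not (eval u A)
eval u (A ∧ᶠ B) = eval u A ∧ eval u B
eval u (A ∨ᶠ B) = eval u A ∨ eval u B
eval u (A →ᶠ B) = not (eval u A) ∨ eval u B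

record Frame (P : Set a) (r : Level) : Set (a ⊔ suc r) where
  field
    worlds   : Pred (Valuation P) r
    nonempty : Satisfiable worlds

open Frame public

infix 4 _⊨_ _⊨*_

_⊨_ : {P : Set a} → Frame P r → SFormula P → Set (a ⊔ r)
R ⊨ (A ≺ B) = ∀ u → u ∈ worlds R → eval u A ≡ false ⊎ eval u B ≡ true
R ⊨ (A ⊀ B) = ∃[ u ] (u ∈ worlds R × eval u A ≡ true × eval u B ≡ false)

_⊨*_ : {P : Set a} → Frame P r → Pred (SFormula P) γ → Set (a ⊔ r ⊔ γ)
R ⊨* Γ = ∀ φ → φ ∈ Γ → R ⊨ φ

infix 4 _at_

data TFormula (P : Set a) (W : Set b) : Set (a ⊔ b) where
  sform : SFormula P → TFormula P W
  _at_  : Formula P → W → TFormula P W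

-- A set of s-formulas, regarded as a set of tableau formulas.
⟪_⟫ : {P : Set a} {W : Set b} → Pred (SFormula P) γ → Pred (TFormula P W) γ
⟪ Γ ⟫ (sform φ) = φ ∈ Γ
⟪ Γ ⟫ (A at w)  = ⊥

Label : Set a → Set b → (ℓ : Level) → Set (a ⊔ b ⊔ suc ℓ)
Label P W ℓ = Pred (TFormula P W) ℓ

infixl 6 _,,_

_,,_ : {P : Set a} {W : Set b} → Label P W ℓ → List (TFormula P W) → Label P W (a ⊔ b ⊔ ℓ)
Δ ,, φs = Δ ∪ (_∈ˡ φs)

Mentions : {P : Set a} {W : Set b} → Label P W ℓ → W → Set (a ⊔ ℓ)
Mentions X w = ∃[ A ] ((A at w) ∈ X)

-- Rule Fresh φs ψss is the schema  Δ, φs ⇒ Δ, ψs₁ ∣ Δ, ψs₂ ∣ …  with ψs₁, ψs₂, …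
-- the entries of ψss.  Fresh holds of the world variables allowed as new ones.
data Rule {P : Set a} {W : Set b} (Fresh : Pred W ℓ) :
          List (TFormula P W) → List (List (TFormula P W)) → Set (a ⊔ b ⊔ ℓ) where
  ∨-rule  : ∀ A B w → Rule Fresh ((A ∨ᶠ B at w) ∷ [])
              (((A at w) ∷ []) ∷ ((B at w) ∷ []) ∷ [])
  ¬∨-rule : ∀ A B w → Rule Fresh ((¬ᶠ (A ∨ᶠ B) at w) ∷ [])
              (((¬ᶠ A at w) ∷ (¬ᶠ B at w) ∷ []) ∷ [])
  ∧-rule  : ∀ A B w → Rule Fresh ((A ∧ᶠ B at w) ∷ [])
              (((A at w) ∷ (B at w) ∷ []) ∷ [])
  ¬∧-rule : ∀ A B w → Rule Fresh ((¬ᶠ (A ∧ᶠ B) at w) ∷ [])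
              (((¬ᶠ A at w) ∷ []) ∷ ((¬ᶠ B at w) ∷ []) ∷ [])
  →-rule  : ∀ A B w → Rule Fresh ((A →ᶠ B at w) ∷ [])
              (((¬ᶠ A at w) ∷ []) ∷ ((B at w) ∷ []) ∷ [])
  ¬→-rule : ∀ A B w → Rule Fresh ((¬ᶠ (A →ᶠ B) at w) ∷ [])
              (((A at w) ∷ (¬ᶠ B at w) ∷ []) ∷ [])
  ≺-rule  : ∀ A B w → Rule Fresh (sform (A ≺ B) ∷ [])
              (((¬ᶠ A at w) ∷ []) ∷ ((B at w) ∷ []) ∷ [])
  ⊀-rule  : ∀ A B v → v ∈ Fresh → Rule Fresh (sform (A ⊀ B) ∷ [])
              (((A at v) ∷ (¬ᶠ B at v) ∷ []) ∷ [])
  C-rule  : ∀ A w → Rule Fresh []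
              (((A at w) ∷ []) ∷ ((¬ᶠ A at w) ∷ []) ∷ [])
  ¬¬-rule : ∀ A w → Rule Fresh ((¬ᶠ ¬ᶠ A at w) ∷ [])
              (((A at w) ∷ []) ∷ [])

data Tree (P : Set a) (W : Set b) (ℓ : Level) : Set (a ⊔ b ⊔ suc ℓ) where
  node : Label P W ℓ → List (Tree P W ℓ) → Tree P W ℓ

root : {P : Set a} {W : Set b} → Tree P W ℓ → Label P W ℓ
root (node X _) = X

NewFor : {P : Set a} {W : Set b} → List (Label P W ℓ) → Pred W (a ⊔ b ⊔ suc ℓ)
NewFor Xs v = All (λ X → ¬ Mentions X v) Xs

-- WellFormed anc t: every inner node of t is expanded by a rule, where anc lists
-- the labels of the proper ancestors of the root of t.
data WellFormed {P : Set a} {W : Set b} {ℓ : Level} (anc : List (Label P W ℓ)) :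
                Tree P W ℓ → Set (a ⊔ b ⊔ suc ℓ) where
  leaf  : ∀ {X} → WellFormed anc (node X [])
  inner : ∀ {X ts φs ψss} (Δ : Label P W ℓ) →
          Rule (NewFor (X ∷ anc)) φs ψss →
          X ≐ (Δ ,, φs) →
          Pointwise (λ t ψs → root t ≐ (Δ ,, ψs)) ts ψss →
          All (WellFormed (X ∷ anc)) ts →
          WellFormed anc (node X ts)

infix 4 _IsTableauFor_

_IsTableauFor_ : {P : Set a} {W : Set b} → Tree P W ℓ → Pred (TFormula P W) γ →
                 Set (a ⊔ b ⊔ suc ℓ ⊔ γ)
t IsTableauFor Γ = root t ≐ Γ × WellFormed [] t

-- MaximalBranch t Xs: Xs lists the labels along a path from the root of t to a leaf.
data MaximalBranch {P : Set a} {W : Set b} {ℓ : Level} :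
                   Tree P W ℓ → List (Label P W ℓ) → Set (a ⊔ b ⊔ suc ℓ) where
  end  : ∀ {X} → MaximalBranch (node X []) (X ∷ [])
  step : ∀ {X t ts Xs} → t ∈ˡ ts → MaximalBranch t Xs → MaximalBranch (node X ts) (X ∷ Xs)

Clash : {P : Set a} {W : Set b} → Label P W ℓ → Set (a ⊔ b ⊔ ℓ)
Clash X = ∃[ A ] ∃[ w ] ((A at w) ∈ X × (¬ᶠ A at w) ∈ X)

ClosedBranch : {P : Set a} {W : Set b} → List (Label P W ℓ) → Set (a ⊔ b ⊔ suc ℓ)
ClosedBranch Xs = Any Clash Xs

Closed : {P : Set a} {W : Set b} → Tree P W ℓ → Set (a ⊔ b ⊔ suc ℓ)
Closed t = ∀ Xs → MaximalBranch t Xs → ClosedBranch Xs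

{-# OPTIONS --safe #-}

-- If a frame satisfies Γ, interpret every world variable by a valuation of the frame.
-- Each rule preserves, for at least one child, the existence of an interpretation under
-- which the whole label is true (rule ⊀ reinterprets its new variable by a witness of the
-- nonimplication).  Following such children leads to a maximal branch without clash.
-- Equality on W is not decidable, so an interpretation cannot be updated at a single
-- variable as a function W → Valuation P; it is a functional relation, total up to
-- double negation, which suffices because the conclusion is a negation.

module Submission where

open import Defs
open import Data.Bool.Base using (true; false; not; _∧_; _∨_)
open import Data.Bool.Properties
  using (∧-conicalˡ; ∧-conicalʳ; ∨-inverseʳ; not-involutive; not-¬; ∨-∧-booleanAlgebra)
open import Algebra.Lattice.Properties.BooleanAlgebra ∨-∧-booleanAlgebra
  using (deMorgan₁; deMorgan₂)
open import Data.List.Base using (List; []; _∷_)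
open import Data.List.Relation.Binary.Pointwise.Base using (Pointwise; []; _∷_)
open import Data.List.Relation.Unary.All using (All; []; _∷_; lookup; tabulate)
open import Data.List.Relation.Unary.Any using (Any; here; there)
open import Data.List.Membership.Propositional using () renaming (_∈_ to _∈ˡ_)
open import Data.Product.Base using (Σ-syntax; ∃-syntax; _×_; _,_; proj₁; proj₂)
open import Data.Sum.Base using (_⊎_; inj₁; inj₂; [_,_]′)
open import Function.Base using (_∘_)
open import Level using (Level; Lift; lift; _⊔_; suc)
open import Relation.Binary.PropositionalEquality
  using (_≡_; refl; sym; trans; cong; subst)
open import Relation.Nullary using (¬_; yes; no; contradiction)
open import Relation.Nullary.Decidable using (¬¬-excluded-middle)
open import Relation.Unary using (Pred; _∈_; _⊆_; _≐_)

private
  variable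
    a b ℓ ℓ′ r : Level

∨-true : ∀ x {y} → x ∨ y ≡ true → x ≡ true ⊎ y ≡ true
∨-true true  _ = inj₁ refl
∨-true false e = inj₂ e

module _ {P : Set a} {W : Set b} (R : Frame P r) where

  record Interpretation : Set (suc (a ⊔ b) ⊔ r) where
    field
      _↦_        : W → Valuation P → Set (a ⊔ b)
      total      : ∀ w → ¬ ¬ (∃[ u ] (w ↦ u))
      functional : ∀ {w u u′} → w ↦ u → w ↦ u′ → u ≡ u′
      in-frame   : ∀ {w u} → w ↦ u → u ∈ worlds R

  open Interpretation

  constant : ∀ {u} → u ∈ worlds R → Interpretation
  constant {u} u∈R = record
    { _↦_        = λ _ u′ → Lift (a ⊔ b) (u′ ≡ u)
    ; total      = λ _ k → k (u , lift refl)
    ; functional = λ { (lift refl) (lift refl) → refl }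
    ; in-frame   = λ { (lift refl) → u∈R }
    }

  update : Interpretation → W → ∀ {u} → u ∈ worlds R → Interpretation
  update ρ v {u} u∈R = record
    { _↦_        = λ w u′ → (w ≡ v × u′ ≡ u) ⊎ (¬ w ≡ v × (ρ ↦ w) u′)
    -- The goal is absurdity, so `w ≡ v` may be decided here.
    ; total      = λ w k → ¬¬-excluded-middle λ
        { (yes w≡v) → k (u , inj₁ (w≡v , refl))
        ; (no w≢v)  → total ρ w λ (u′ , w↦u′) → k (u′ , inj₂ (w≢v , w↦u′))
        }
    ; functional = λ
        { (inj₁ (_ , refl))  (inj₁ (_ , refl)) → refl
        ; (inj₁ (w≡v , _))   (inj₂ (w≢v , _))  → contradiction w≡v w≢v
        ; (inj₂ (w≢v , _))   (inj₁ (w≡v , _))  → contradiction w≡v w≢v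
        ; (inj₂ (_ , w↦u₁))  (inj₂ (_ , w↦u₂)) → functional ρ w↦u₁ w↦u₂
        }
    ; in-frame   = [ (λ { (_ , refl) → u∈R }) , in-frame ρ ∘ proj₂ ]′
    }

  -- Quantifying over all values of `w` lets truth be asserted without producing a value. Values are
  -- unique, so one value suffices to establish it (`holds-at`); `total` keeps it from being
  -- vacuous.
  data Holds (ρ : Interpretation) : TFormula P W → Set (a ⊔ b ⊔ r) where
    sform : ∀ {φ} → R ⊨ φ → Holds ρ (sform φ)
    world : ∀ {A w} → (∀ u → (ρ ↦ w) u → eval u A ≡ true) → Holds ρ (A at w)

  holds-at : ∀ {ρ w u} A → (ρ ↦ w) u → eval u A ≡ true → Holds ρ (A at w)
  holds-at {ρ} A w↦u e =
    world λ u′ w↦u′ → subst (λ u → eval u A ≡ true) (functional ρ w↦u w↦u′) e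

  -- S-formulas do not depend on the interpretation, and the only variable whose value changes
  -- labels no formula of `X`.
  holds-update : ∀ {ρ v u} (u∈R : u ∈ worlds R) (X : Label P W ℓ) → ¬ Mentions X v →
                 X ⊆ Holds ρ → X ⊆ Holds (update ρ v u∈R)
  holds-update u∈R X new X-holds {φ} φ∈X with X-holds φ∈X
  ... | sform h = sform h
  ... | world h = world λ
    { u (inj₁ (refl , _))  → contradiction (_ , φ∈X) new
    ; u (inj₂ (_ , w↦u))   → h u w↦u
    }

  -- A value of the rule's world variable decides which child survives, and values exist only up to
  -- double negation. All of `X` is carried over to `ρ′`, since the side formulas of the rule must
  -- stay true as well.
  rule-sound : ∀ {ρ} {Fresh : Pred W ℓ′} {φs ψss} (X : Label P W ℓ) →
               (∀ {v} → v ∈ Fresh → ¬ Mentions X v) →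
               Rule Fresh φs ψss → X ⊆ Holds ρ → All (Holds ρ) φs →
               ¬ ¬ (∃[ ρ′ ] (X ⊆ Holds ρ′ × Any (All (Holds ρ′)) ψss))
  rule-sound {ρ = ρ} {ψss = ψss} X new rule X-holds = premises rule
    where
    Conclusion = ∃[ ρ′ ] (X ⊆ Holds ρ′ × Any (All (Holds ρ′)) ψss)

    -- Serves every rule except `⊀-rule`: `ρ` is unchanged and a value of `w` selects the child.
    keeping : ∀ w → (∀ u → (ρ ↦ w) u → Any (All (Holds ρ)) ψss) → ¬ ¬ Conclusion
    keeping w f k = total ρ w λ (u , w↦u) → k (ρ , X-holds , f u w↦u)

    both : ∀ A B {w u} → (ρ ↦ w) u → eval u A ∧ eval u B ≡ true →
           Any (All (Holds ρ)) (((A at w) ∷ (B at w) ∷ []) ∷ [])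
    both A B {u = u} w↦u e = here
      ( holds-at A w↦u (∧-conicalˡ (eval u A) _ e)
      ∷ holds-at B w↦u (∧-conicalʳ (eval u A) _ e) ∷ [])

    either : ∀ A B {w u} → (ρ ↦ w) u → eval u A ∨ eval u B ≡ true →
             Any (All (Holds ρ)) (((A at w) ∷ []) ∷ ((B at w) ∷ []) ∷ [])
    either A B {u = u} w↦u e with ∨-true (eval u A) e
    ... | inj₁ eA = here (holds-at A w↦u eA ∷ [])
    ... | inj₂ eB = there (here (holds-at B w↦u eB ∷ []))

    premises : ∀ {φs} → Rule _ φs ψss → All (Holds ρ) φs → ¬ ¬ Conclusion
    premises (∨-rule A B w) (world h ∷ []) = keeping w λ u w↦u →
      either A B w↦u (h u w↦u)
    premises (¬∨-rule A B w) (world h ∷ []) = keeping w λ u w↦u →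
      both (¬ᶠ A) (¬ᶠ B) w↦u (trans (sym (deMorgan₂ (eval u A) _)) (h u w↦u))
    premises (∧-rule A B w) (world h ∷ []) = keeping w λ u w↦u →
      both A B w↦u (h u w↦u)
    premises (¬∧-rule A B w) (world h ∷ []) = keeping w λ u w↦u →
      either (¬ᶠ A) (¬ᶠ B) w↦u (trans (sym (deMorgan₁ (eval u A) _)) (h u w↦u))
    premises (→-rule A B w) (world h ∷ []) = keeping w λ u w↦u →
      either (¬ᶠ A) B w↦u (h u w↦u)
    premises (¬→-rule A B w) (world h ∷ []) = keeping w λ u w↦u →
      both A (¬ᶠ B) w↦u
        -- An implication evaluates as `not x ∨ y`, so De Morgan leaves a double negation on `A` to
        -- cancel.
        (trans (cong (_∧ not (eval u B)) (sym (not-involutive (eval u A))))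
          (trans (sym (deMorgan₂ (not (eval u A)) _)) (h u w↦u)))
    premises (≺-rule A B w) (sform h ∷ []) = keeping w λ u w↦u →
      [ (λ eA → here (holds-at (¬ᶠ A) w↦u (cong not eA) ∷ []))
      , (λ eB → there (here (holds-at B w↦u eB ∷ [])))
      -- The strict implication speaks of worlds of `R` only; `in-frame` makes it applicable to `u`.
      ]′ (h u (in-frame ρ w↦u))
    premises (⊀-rule A B v v-fresh) (sform (u , u∈R , eA , eB) ∷ []) k =
      k ( update ρ v u∈R
        , holds-update u∈R X (new v-fresh) X-holds
        , here (holds-at A v↦u eA ∷ holds-at (¬ᶠ B) v↦u (cong not eB) ∷ []) )
      where
      v↦u : (update ρ v u∈R ↦ v) u
      v↦u = inj₁ (refl , refl)
    premises (C-rule A w) [] = keeping w λ u w↦u →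
      either A (¬ᶠ A) w↦u (∨-inverseʳ (eval u A))
    premises (¬¬-rule A w) (world h ∷ []) = keeping w λ u w↦u →
      here (holds-at A w↦u (trans (sym (not-involutive (eval u A))) (h u w↦u)) ∷ [])

  -- Any value of the clashing variable would make `A` both true and false, and `total` forbids
  -- having no value.
  clash-free : ∀ {ρ} (X : Label P W ℓ) → X ⊆ Holds ρ → ¬ Clash X
  clash-free {ρ = ρ} X X-holds (A , w , A∈X , ¬A∈X) with X-holds A∈X | X-holds ¬A∈X
  ... | world h | world h¬ = total ρ w λ (u , w↦u) →
    not-¬ refl (trans (h u w↦u) (sym (h¬ u w↦u)))

  OpenBranch : Tree P W ℓ → Set _
  OpenBranch t = ∃[ Xs ] (MaximalBranch t Xs × ¬ ClosedBranch Xs)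

  open-branch : ∀ {ρ anc} {t : Tree P W ℓ} → WellFormed anc t → root t ⊆ Holds ρ →
                ¬ ¬ OpenBranch t
  -- Walks the children in parallel with the conclusions of the rule up to the conclusion that
  -- holds; the child there has a true label, and `open-branch` continues from it.
  open-branch-below : ∀ {ρ anc ts ψss} {Δ : Label P W ℓ} → All (WellFormed anc) ts →
                      Pointwise (λ t ψs → root t ≐ (Δ ,, ψs)) ts ψss →
                      Δ ⊆ Holds ρ → Any (All (Holds ρ)) ψss →
                      ¬ ¬ (∃[ t ] (t ∈ˡ ts × OpenBranch t))

  open-branch (leaf {X}) X-holds k = k (_ , end , λ { (here c) → clash-free X X-holds c })
  open-branch (inner {X} Δ rule (_ , ⊆X) children wfs) X-holds k =
    rule-sound X (λ { (new ∷ _) → new }) rule X-holds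
      (tabulate (X-holds ∘ ⊆X ∘ inj₂))
      λ (_ , X-holds′ , child-holds) →
        open-branch-below wfs children (X-holds′ ∘ ⊆X ∘ inj₁) child-holds
          λ (_ , t∈ts , Xs , branch , ¬closed) →
            k ( X ∷ Xs , step t∈ts branch
              , λ { (here c) → clash-free X X-holds c ; (there c) → ¬closed c } )

  open-branch-below (wf ∷ _) ((⊆Δψs , _) ∷ _) Δ-holds (here ψs-hold) k =
    open-branch wf ([ Δ-holds , lookup ψs-hold ]′ ∘ ⊆Δψs)
      λ o → k (_ , here refl , o)
  open-branch-below (_ ∷ wfs) (_ ∷ children) Δ-holds (there any) k =
    open-branch-below wfs children Δ-holds any
      λ (t , t∈ts , o) → k (t , there t∈ts , o)

theorem8 : ∀ {a b γ ℓ r} (P : Set a) (W : Set b) → Infinite P → Infinite W →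
    (Γ : Pred (SFormula P) γ) →
    Σ[ t ∈ Tree P W ℓ ] (t IsTableauFor ⟪ Γ ⟫ × Closed t) →
    (R : Frame P r) → ¬ (R ⊨* Γ)
theorem8 P W _ _ Γ (t , ((root⊆Γ , _) , wf) , closed) R R⊨Γ =
  open-branch R wf (Γ-holds ∘ root⊆Γ)
    λ (Xs , branch , ¬closed) → ¬closed (closed Xs branch)
  where
  Γ-holds : ∀ {φ : TFormula P W} → φ ∈ ⟪ Γ ⟫ →
            Holds R (constant R (proj₂ (nonempty R))) φ
  -- `⟪ Γ ⟫` contains no formula `A at w`, so any world of the frame can start the interpretation.
  Γ-holds {sform φ} φ∈Γ = sform (R⊨Γ φ φ∈Γ)
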